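{- Let $X$ be the point set of a permutation of $[n]$, and let $\mathrm{Opt}(X)$ be a minimum-cardinality set of points that must be added to $X$ to make it arborally satisfied. Then $$|X\cup \mathrm{Opt}(X)|\ \ge\ \frac{|\mathrm{Good}(\mathrm{Zag})|}{2}+|X| .$$
   Context: A permutation $(p_1,\dots,p_n)$ of $[n]=\{1,\dots,n\}$ is represented by $X=\{(p_i,i): i\in[n]\}\subset\mathbb R^2$. Coordinates of a point $a$ are $a.x$ (key) and $a.y$ (time); the $y$-axis points downwards. So $a$ is above $b$ if $a.x=b.x$, $a.y<b.y$; $a$ is left of $b$ (and $b$ right of $a$) if $a.y=b.y$, $a.x<b.x$; $a$ is north-west of $b$ if $a.x<b.x$, $a.y<b.y$; $a$ is north-east of $b$ if $a.x>b.x$, $a.y<b.y$. For $a,b$ not on a common horizontal or vertical line, $\Box(a,b)$ is the closed axis-parallel rectangle with opposite corners $a,b$; it is satisfied with respect to $P$ if $P\setminus\{a,b\}$ contains a point of $\Box(a,b)$. A set $P$ is arborally satisfied if for all $a,b\in P$ on no common horizontal or vertical line, $\Box(a,b)$ is satisfied with respect to $P$. $\mathrm{Greedy}$ processes times $t=1,\dots,n$. At time $t$, let $p\in X$ with $p.y=t$ and let $P_{<t}$ be the set of points of $X$ and points marked so far with $y$-coordinate $<t$. For every $a\in P_{<t}$ with $a.x\neq p.x$ such that $\Box(p,a)$ is not satisfied with respect to $P_{<t}\cup\{p\}$, it marks $(a.x,t)$ (all rectangles considered simultaneously). $G$ is the set of all marked points. For $a\in X\cup G$, $\mathrm{Op}(a)$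 is the unique point of $X$ with the same $y$-coordinate as $a$. For $p\in G$ let $q$ be the first (closest) point of $X\cup G$ above $p$ (it exists) and put $\mathrm{Pair}(p)=(\mathrm{Op}(p),\mathrm{Op}(q))\in X^2$. We say $\mathrm{Pair}(p)\in\mathrm{Zag}$ (a condition on $p$) if either $p$ is right of $\mathrm{Op}(p)$ and $\mathrm{Op}(q)$ is above or north-east of $p$, or $p$ is left of $\mathrm{Op}(p)$ and $\mathrm{Op}(q)$ is above or north-west of $p$. $\mathrm{Zag}$ is the set of all pairs $\mathrm{Pair}(p)$ with $p\in G$ satisfying this condition. A pair $(p,q)\in\mathrm{Zag}$ is good if the interior of $\Box(p,q)$ contains no point of $X$. $\mathrm{Good}(\mathrm{Zag})$ is the set of good pairs.
   Formalization: Points of the plane, in particular those of Opt(X) and of the sets it is compared with for minimality, have rational instead of real coordinates. -}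

module Defs where

open import Data.Fin using (toℕ)
open import Data.Fin.Permutation using (Permutation′; _⟨$⟩ʳ_)
open import Data.Integer using (+_)
open import Data.List using (List; []; _∷_; _++_; map; filter; length; tabulate; deduplicate; cartesianProduct)
open import Data.List.Relation.Unary.All using (All; all?)
open import Data.List.Relation.Unary.Any using (Any; any?)
open import Data.Nat as ℕ using (ℕ; suc)
open import Data.Product using (_×_; _,_; uncurry)
open import Data.Product.Properties using (≡-dec)
open import Data.Rational using (ℚ; _/_; _≤_; _<_; _⊓_; _⊔_)
import Data.Rational.Properties as ℚ
open import Data.Sum using (_⊎_)
open import Relation.Binary.Definitions using (DecidableEquality)
open import Relation.Binary.PropositionalEquality using (_≡_; _≢_; refl; cong₂)
open import Relation.Nullary using (Dec; ¬_)
open import Relation.Nullary.Decidable using (map′; ¬?; _×-dec_; _⊎-dec_; _→-dec_)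
open import Relation.Unary using (Decidable)

-- Coordinates range over ℚ in place of ℝ: the geometry below uses only the
-- order of the coordinates. The y-axis (time) points downwards.
record Point : Set where
  constructor point
  field
    x y : ℚ

open Point public

infix 4 _≟_
_≟_ : DecidableEquality Point
point a b ≟ point c d =
  map′ (uncurry (cong₂ point)) (λ { refl → refl , refl })
       ((a ℚ.≟ c) ×-dec (b ℚ.≟ d))

_≟²_ : DecidableEquality (Point × Point)
_≟²_ = ≡-dec _≟_ _≟_

open import Data.List.Membership.DecPropositional _≟_ public using (_∈_; _∈?_)

-- Finite sets are lists; neither order nor multiplicity is significant, and
-- cardinality counts distinct elements.
card : List Point → ℕ
card P = length (deduplicate _≟_ P)

card² : List (Point × Point) → ℕ
card² Z = length (deduplicate _≟²_ Z)

fromℕ : ℕ → ℚ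
fromℕ k = + k / 1

-- The points (pᵢ , i), listed by increasing time; Fin n counts from 0, whence suc.
points : ∀ {n} → Permutation′ n → List Point
points π = tabulate λ i →
  point (fromℕ (suc (toℕ (π ⟨$⟩ʳ i)))) (fromℕ (suc (toℕ i)))

-- The first argument lies above, left of, ... the second.
Above LeftOf RightOf NorthWest NorthEast : Point → Point → Set
Above     a b = x a ≡ x b × y a < y b
LeftOf    a b = y a ≡ y b × x a < x b
RightOf   a b = LeftOf b a
NorthWest a b = x a < x b × y a < y b
NorthEast a b = x b < x a × y a < y b

Box : Point → Point → Point → Set
Box a b c = (x a ⊓ x b ≤ x c × x c ≤ x a ⊔ x b)
          × (y a ⊓ y b ≤ y c × y c ≤ y a ⊔ y b)

Interior : Point → Point → Point → Set
Interior a b c = (x a ⊓ x b < x c × x c < x a ⊔ x b)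
               × (y a ⊓ y b < y c × y c < y a ⊔ y b)

Satisfied : List Point → Point → Point → Set
Satisfied P a b = Any (λ c → Box a b c × c ≢ a × c ≢ b) P

ArborallySatisfied : List Point → Set
ArborallySatisfied P =
  ∀ {a b} → a ∈ P → b ∈ P → x a ≢ x b → y a ≢ y b → Satisfied P a b

record IsOpt (X Y : List Point) : Set where
  field
    satisfied : ArborallySatisfied (X ++ Y)
    minimum   : ∀ Z → ArborallySatisfied (X ++ Z) → card Y ℕ.≤ card Z

Box? : ∀ a b c → Dec (Box a b c)
Box? a b c =
  (((x a ⊓ x b) ℚ.≤? x c) ×-dec (x c ℚ.≤? (x a ⊔ x b)))
  ×-dec
  (((y a ⊓ y b) ℚ.≤? y c) ×-dec (y c ℚ.≤? (y a ⊔ y b)))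

Interior? : ∀ a b c → Dec (Interior a b c)
Interior? a b c =
  (((x a ⊓ x b) ℚ.<? x c) ×-dec (x c ℚ.<? (x a ⊔ x b)))
  ×-dec
  (((y a ⊓ y b) ℚ.<? y c) ×-dec (y c ℚ.<? (y a ⊔ y b)))

Satisfied? : ∀ P a b → Dec (Satisfied P a b)
Satisfied? P a b = any? (λ c → Box? a b c ×-dec ¬? (c ≟ a) ×-dec ¬? (c ≟ b)) P

-- The points marked at time y p, where P consists of all earlier points.
marks : List Point → Point → List Point
marks P p = map (λ a → point (x a) (y p))
  (filter (λ a → ¬? (x a ℚ.≟ x p) ×-dec ¬? (Satisfied? (p ∷ P) p a)) P)

-- P collects the points of X and the marked points at earlier times; the second
-- argument lists the remaining points of X by increasing time. Only marked
-- points are returned.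
greedyFrom : List Point → List Point → List Point
greedyFrom P []      = []
greedyFrom P (p ∷ X) = marks P p ++ greedyFrom (marks P p ++ p ∷ P) X

greedy : List Point → List Point
greedy = greedyFrom []

-- o = Op(a)
IsOp : List Point → Point → Point → Set
IsOp X a o = o ∈ X × y o ≡ y a

FirstAbove : List Point → Point → Point → Set
FirstAbove P p q = Above q p × All (λ r → Above r p → y r ≤ y q) P

-- For o = Op(p) and o′ = Op(q), where q is the first point above p.
ZagCondition : Point → Point → Point → Set
ZagCondition p o o′ = (RightOf p o × (Above o′ p ⊎ NorthEast o′ p))
                    ⊎ (LeftOf p o × (Above o′ p ⊎ NorthWest o′ p))

-- (o , o′) = Pair(p) for some p ∈ G for which the Zag condition holds.
InZag : List Point → Point × Point → Set
InZag X (o , o′) =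
  Any (λ p → Any (λ q → FirstAbove (X ++ greedy X) p q × IsOp X p o × IsOp X q o′
                      × ZagCondition p o o′)
                 (X ++ greedy X))
      (greedy X)

IsGood : List Point → Point × Point → Set
IsGood X (a , b) = All (λ c → ¬ Interior a b c) X

Above? : ∀ a b → Dec (Above a b)
Above? a b = (x a ℚ.≟ x b) ×-dec (y a ℚ.<? y b)

LeftOf? : ∀ a b → Dec (LeftOf a b)
LeftOf? a b = (y a ℚ.≟ y b) ×-dec (x a ℚ.<? x b)

ZagCondition? : ∀ p o o′ → Dec (ZagCondition p o o′)
ZagCondition? p o o′ =
  (LeftOf? o p ×-dec (Above? o′ p ⊎-dec ((x p ℚ.<? x o′) ×-dec (y o′ ℚ.<? y p))))
  ⊎-dec
  (LeftOf? p o ×-dec (Above? o′ p ⊎-dec ((x o′ ℚ.<? x p) ×-dec (y o′ ℚ.<? y p))))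

InZag? : ∀ X → Decidable (InZag X)
InZag? X (o , o′) =
  any? (λ p → any? (λ q →
    (Above? q p ×-dec all? (λ r → Above? r p →-dec (y r ℚ.≤? y q)) (X ++ greedy X))
    ×-dec ((o ∈? X) ×-dec (y o ℚ.≟ y p))
    ×-dec ((o′ ∈? X) ×-dec (y o′ ℚ.≟ y q))
    ×-dec ZagCondition? p o o′)
  (X ++ greedy X)) (greedy X)

IsGood? : ∀ X → Decidable (IsGood X)
IsGood? X (a , b) = all? (λ c → ¬? (Interior? a b c)) X

Zag : List Point → List (Point × Point)
Zag X = filter (InZag? X) (cartesianProduct X X)

Good : List Point → List (Point × Point) → List (Point × Point)
Good X = filter (IsGood? X)

{-# OPTIONS --safe #-}

-- By reflection it is enough to show that an arborally satisfied P ⊇ X has at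
-- least |X| + N points, where N counts the good Zag pairs (o , o′) with o′ to
-- the right of o; applying this to both orientations and averaging gives the
-- claim. If the pair comes from p and the first point q above it, then
-- the rectangle of o and o′ contains no point of X ∪ G in its interior, and
-- the segment from p to q, which crosses it from bottom to top, determines a
-- vertical cut. As P is satisfied, some two horizontally adjacent points u, v of
-- P in the rectangle are separated by the cut; charge the pair to the right one,
-- v. Two pairs with the same charge would put a point p, q or o′ of one into the
-- interior of the rectangle of the other, a point into the empty box of its o
-- and q, or a mark above the point of X in its column. Charged points are never
-- leftmost in their row of P, and the rows of X provide |X| leftmost points.

module Submission where

open import Defs
open import Data.Nat using (ℕ)
open import Data.Integer using (+_)
open import Data.List using (List; _++_)
open import Data.Fin.Permutation using (Permutation′)
open import Data.Rational using (_/_; _+_; _≥_)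

open import Data.Empty using (⊥)
open import Data.Fin as Fin using (Fin)
import Data.Fin.Properties as Fin
open import Data.Fin.Permutation using (_⟨$⟩ʳ_)
import Data.Integer as ℤ
import Data.Integer.Properties as ℤ
open import Data.List using ([]; _∷_; map; filter; length; deduplicate; lookup; cartesianProduct)
open import Data.List.Membership.Propositional.Properties
  using (∈-++⁺ˡ; ∈-++⁺ʳ; ∈-++⁻; ∈-map⁻; ∈-filter⁻; ∈-tabulate⁻; ∈-deduplicate⁺; ∈-deduplicate⁻; ∈-lookup)
open import Data.List.Relation.Unary.Any.Properties using (lookup-index)
import Data.List.Membership.Propositional as List
open import Data.List.Properties using (length-++; length-map)
open import Data.List.Relation.Unary.All as All using (All; []; _∷_)
open import Data.List.Relation.Unary.AllPairs using (AllPairs; []; _∷_)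
import Data.List.Relation.Unary.AllPairs.Properties as AllPairs
open import Data.List.Relation.Unary.Any as Any using (here; there)
open import Data.List.Relation.Unary.Unique.Propositional using (Unique)
import Data.List.Relation.Unary.Unique.DecPropositional.Properties as Unique
import Data.List.Relation.Unary.Unique.Propositional.Properties as Unique
import Data.Nat as ℕ
open import Data.Nat.Induction using (Acc; acc; <-wellFounded)
import Data.Nat.Properties as ℕ
open import Data.Nat.Solver using (module +-*-Solver)
open import Data.Product using (_×_; _,_; proj₁; proj₂; ∃)
open import Data.Rational using (ℚ; -_; _≤_; _<_; _⊓_; _⊔_; toℚᵘ)
import Data.Rational.Properties as ℚ
open import Algebra.Properties.Group ℚ.+-0-group using () renaming (⁻¹-involutive to neg-involutive)
import Data.Rational.Unnormalised as ℚᵘ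
import Data.Rational.Unnormalised.Properties as ℚᵘ
open import Data.Sum using (_⊎_; inj₁; inj₂; [_,_]′)
open import Function using (_∘_; id; Injection)
open import Function.Properties.Inverse using (↔⇒↣)
open import Relation.Binary.Definitions using (tri<; tri≈; tri>)
open import Relation.Binary.PropositionalEquality
  using (_≡_; refl; sym; trans; cong; cong₂; subst; subst₂)
open import Relation.Nullary using (¬_; yes; no; contradiction)
open import Relation.Nullary.Decidable using (¬?; _×-dec_; decidable-stable)
open import Relation.Unary using (Decidable)

-- Counting in finite lists

module _ {A : Set} {P Q : A → Set} (P? : Decidable P) (Q? : Decidable Q) (P⊆Q : ∀ {a} → P a → Q a) where

  length-filter-mono : ∀ as → length (filter P? as) ℕ.≤ length (filter Q? as)
  length-filter-mono [] = ℕ.z≤n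
  length-filter-mono (a ∷ as) with P? a | Q? a
  ... | yes _  | yes _  = ℕ.s≤s (length-filter-mono as)
  ... | yes Pa | no ¬Qa = contradiction (P⊆Q Pa) ¬Qa
  ... | no _   | yes _  = ℕ.m≤n⇒m≤1+n (length-filter-mono as)
  ... | no _   | no _   = length-filter-mono as

  length-filter-< : ∀ {a as} → a List.∈ as → ¬ P a → Q a →
                    length (filter P? as) ℕ.< length (filter Q? as)
  length-filter-< {a} {.a ∷ as} (here refl) ¬Pa Qa with P? a | Q? a
  ... | yes Pa | _      = contradiction Pa ¬Pa
  ... | no _   | yes _  = ℕ.s≤s (length-filter-mono as)
  ... | no _   | no ¬Qa = contradiction Qa ¬Qa
  length-filter-< {as = b ∷ _} (there a∈as) ¬Pa Qa with P? b | Q? b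
  ... | yes _  | yes _  = ℕ.s≤s (length-filter-< a∈as ¬Pa Qa)
  ... | yes Pb | no ¬Qb = contradiction (P⊆Q Pb) ¬Qb
  ... | no _   | yes _  = ℕ.m<n⇒m<1+n (length-filter-< a∈as ¬Pa Qa)
  ... | no _   | no _   = length-filter-< a∈as ¬Pa Qa

length-filter-∁ : ∀ {A : Set} {P : A → Set} (P? : Decidable P) as →
                  length (filter P? as) ℕ.+ length (filter (¬? ∘ P?) as) ≡ length as
length-filter-∁ P? [] = refl
length-filter-∁ P? (a ∷ as) with P? a
... | yes _ = cong ℕ.suc (length-filter-∁ P? as)
... | no _  = trans (ℕ.+-suc _ _) (cong ℕ.suc (length-filter-∁ P? as))

lookup-injective : ∀ {A : Set} {as : List A} → Unique as →
                   ∀ {i j} → lookup as i ≡ lookup as j → i ≡ j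
lookup-injective (_ ∷ _)    {Fin.zero}  {Fin.zero}  _  = refl
lookup-injective (a∉ ∷ _)   {Fin.zero}  {Fin.suc j} eq = contradiction eq (All.lookup a∉ (∈-lookup j))
lookup-injective (a∉ ∷ _)   {Fin.suc i} {Fin.zero}  eq = contradiction (sym eq) (All.lookup a∉ (∈-lookup i))
lookup-injective (_ ∷ uniq) {Fin.suc i} {Fin.suc j} eq = cong Fin.suc (lookup-injective uniq eq)

-- A relation stands in for an injection, since the chosen `b` may depend on the membership proof;
-- distinct entries of `as` still get distinct positions in `bs`.
pigeonhole : ∀ {A B : Set} {as : List A} {bs : List B} (R : A → B → Set) →
             (∀ {a a′ b} → R a b → R a′ b → a ≡ a′) → Unique as →
             (∀ {a} → a List.∈ as → ∃ λ b → b List.∈ bs × R a b) →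
             length as ℕ.≤ length bs
pigeonhole {as = as} {bs} R R-injective uniq image = Fin.injective⇒≤ index-injective
  where
  image′ : ∀ i → ∃ λ b → b List.∈ bs × R (lookup as i) b
  image′ i = image (∈-lookup i)

  index : Fin (length as) → Fin (length bs)
  index i = Any.index (image′ i .proj₂ .proj₁)

  index-injective : ∀ {i j} → index i ≡ index j → i ≡ j
  index-injective {i} {j} eq
    with b , b∈ , r ← image′ i | b′ , b′∈ , r′ ← image′ j
    with refl ← trans (lookup-index b∈) (trans (cong (lookup bs) eq) (sym (lookup-index b′∈)))
    = lookup-injective uniq (R-injective r r′)

-- Reflection of the key axis

record Orientation : Set where
  field
    σ           : ℚ → ℚ
    injective   : ∀ {a b} → σ a ≡ σ b → a ≡ b
    -- `Box` and `Interior` use the symmetric bounds `⊓` and `⊔`, which do not see the direction of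
    -- the axis; these fields translate them to and from the order after `σ`.
    between⁺    : ∀ {a b c} → σ a ≤ σ c → σ c ≤ σ b → a ⊓ b ≤ c × c ≤ a ⊔ b
    between⁻    : ∀ {a b c} → σ a ≤ σ b → a ⊓ b ≤ c × c ≤ a ⊔ b → σ a ≤ σ c × σ c ≤ σ b
    between-<⁺  : ∀ {a b c} → σ a < σ c → σ c < σ b → a ⊓ b < c × c < a ⊔ b

increasing : Orientation
increasing = record
  { σ          = id
  ; injective  = id
  ; between⁺   = λ {a} {b} a≤c c≤b → ℚ.≤-trans (ℚ.p⊓q≤p a b) a≤c , ℚ.≤-trans c≤b (ℚ.p≤q⊔p a b)
  ; between⁻   = λ a≤b (l , u) → ℚ.≤-trans (ℚ.⊓-glb ℚ.≤-refl a≤b) l , ℚ.≤-trans u (ℚ.⊔-lub a≤b ℚ.≤-refl)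
  ; between-<⁺ = λ {a} {b} a<c c<b → ℚ.≤-<-trans (ℚ.p⊓q≤p a b) a<c , ℚ.<-≤-trans c<b (ℚ.p≤q⊔p a b)
  }

between-swap : ∀ {a b c} → a ⊓ b ≤ c × c ≤ a ⊔ b → b ⊓ a ≤ c × c ≤ b ⊔ a
between-swap {a} {b} {c} (l , u) = subst (_≤ c) (ℚ.⊓-comm a b) l , subst (c ≤_) (ℚ.⊔-comm a b) u

neg-cancel-≤ : ∀ {a b} → - a ≤ - b → b ≤ a
neg-cancel-≤ {a} {b} = subst₂ _≤_ (neg-involutive b) (neg-involutive a) ∘ ℚ.neg-antimono-≤

neg-cancel-< : ∀ {a b} → - a < - b → b < a
neg-cancel-< {a} {b} = subst₂ _<_ (neg-involutive b) (neg-involutive a) ∘ ℚ.neg-antimono-<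

decreasing : Orientation
decreasing = record
  { σ          = -_
  ; injective  = ℚ.neg-injective
  ; between⁺   = λ {a} {b} a≥c c≥b →
      between-swap {b} (between⁺ (neg-cancel-≤ c≥b) (neg-cancel-≤ a≥c))
  ; between⁻   = λ {a} {b} a≥b bounds →
      let l , u = between⁻ (neg-cancel-≤ a≥b) (between-swap {a} bounds)
      in ℚ.neg-antimono-≤ u , ℚ.neg-antimono-≤ l
  ; between-<⁺ = λ {a} {b} {c} a>c c>b →
      let l , u = between-<⁺ (neg-cancel-< c>b) (neg-cancel-< a>c)
      in subst (_< c) (ℚ.⊓-comm b a) l , subst (c <_) (ℚ.⊔-comm b a) u
  }
  where open Orientation increasing

-- s is Op(r), and a is a point whose unsatisfied box with s makes Greedy mark r.
record Marked (X W : List Point) (r : Point) : Set where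
  field
    {s a}   : Point
    s∈X     : s ∈ X
    y-s     : y s ≡ y r
    a∈W     : a ∈ W
    a-above : Above a r
    clear   : ∀ {c} → c ∈ W → y c < y r → Box s a c → c ≡ a

-- Zag rectangles and crossings of a cut

module Oriented (O : Orientation) where

  open Orientation O

  ξ : Point → ℚ
  ξ = σ ∘ x

  -- a is the lower corner, and the left one for the orientation.
  Box↗ : Point → Point → Point → Set
  Box↗ a b c = (ξ a ≤ ξ c × ξ c ≤ ξ b) × (y b ≤ y c × y c ≤ y a)

  Box↗? : ∀ a b → Decidable (Box↗ a b)
  Box↗? a b c = ((ξ a ℚ.≤? ξ c) ×-dec (ξ c ℚ.≤? ξ b)) ×-dec ((y b ℚ.≤? y c) ×-dec (y c ℚ.≤? y a))

  Box↗⇒Box : ∀ {a b c} → Box↗ a b c → Box a b c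
  Box↗⇒Box {a} {b} ((l , r) , (t , d)) =
    between⁺ l r , between-swap {y b} (Orientation.between⁺ increasing t d)

  Box↗⇒Box-upwards : ∀ {a b c} → ξ b ≤ ξ c → ξ c ≤ ξ a → y b ≤ y c → y c ≤ y a → Box a b c
  Box↗⇒Box-upwards {a} {b} l r t d =
    between-swap {x b} (between⁺ l r) , between-swap {y b} (Orientation.between⁺ increasing t d)

  Box⇒Box↗ : ∀ {a b c} → ξ a ≤ ξ b → y b ≤ y a → Box a b c → Box↗ a b c
  Box⇒Box↗ {a} a≤b b≤a (h , v) =
    between⁻ a≤b h , Orientation.between⁻ increasing b≤a (between-swap {y a} v)

  -- `o` and `p` lie on the bottom row, `q` and `o′` on the top row. `p-o′` is weak because `o′` may
  -- lie above `p`.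
  record ZagRectangle (X G : List Point) (o o′ : Point) : Set where
    field
      {p q}  : Point
      p∈G    : p ∈ G
      q∈W    : q ∈ X ++ G
      first  : FirstAbove (X ++ G) p q
      o∈X    : o ∈ X
      o′∈X   : o′ ∈ X
      y-o    : y o ≡ y p
      y-o′   : y o′ ≡ y q
      o-p    : ξ o < ξ p
      p-o′   : ξ p ≤ ξ o′
      good   : IsGood X (o , o′)

  -- As `u` and `v` share a row, `empty` makes them neighbours there; this is what lets `v`
  -- determine `u`.
  record Crossing (P : List Point) (Left : Point → Set) (a b u v : Point) : Set where
    field
      u∈P   : u ∈ P
      v∈P   : v ∈ P
      left  : Left u
      right : ¬ Left v
      level : y u ≡ y v
      box-u : Box↗ a b u
      box-v : Box↗ a b v
      empty : ∀ {w} → w ∈ P → Box↗ u v w → w ≡ u ⊎ w ≡ v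

  module _ {P : List Point} (satisfied : ArborallySatisfied P)
           {Left : Point → Set} (Left? : Decidable Left)
           (downward : ∀ {a b} → Left b → ξ a ≤ ξ b → Left a) where

    separated : ∀ {a b} → Left a → ¬ Left b → ξ a < ξ b
    separated La ¬Lb = ℚ.≰⇒> (¬Lb ∘ downward La)

    private
      count : Point → Point → ℕ
      count a b = length (filter (Box↗? a b) P)

      -- Induction on the number of points of `P` in the box. A further point `w` of a satisfied box
      -- replaces the corner on its own side of the cut; that corner falls outside the new box, so
      -- the count drops. An unsatisfied box is flat, and its corners are the crossing.
      go : ∀ {a b} → Acc ℕ._<_ (count a b) → a ∈ P → b ∈ P → Left a → ¬ Left b → y b ≤ y a →
           ∃ λ u → ∃ λ v → Crossing P Left a b u v
      go {a} {b} (acc rec) a∈P b∈P La ¬Lb b≤a with Satisfied? P a b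
      ... | no ¬sat = a , b , record
        { u∈P = a∈P ; v∈P = b∈P ; left = La ; right = ¬Lb ; level = level
        ; box-u = (ℚ.≤-refl , a≤b) , (b≤a , ℚ.≤-refl)
        ; box-v = (a≤b , ℚ.≤-refl) , (ℚ.≤-refl , b≤a)
        ; empty = empty }
        where
        a≤b = ℚ.<⇒≤ (separated La ¬Lb)

        -- The cut separates the corners, so their keys differ, and arboreal satisfaction leaves
        -- only a common row.
        level : y a ≡ y b
        level = decidable-stable (y a ℚ.≟ y b)
          (¬sat ∘ satisfied a∈P b∈P (λ e → ℚ.<-irrefl (cong σ e) (separated La ¬Lb)))

        empty : ∀ {w} → w ∈ P → Box↗ a b w → w ≡ a ⊎ w ≡ b
        empty {w} w∈P box with w ≟ a | w ≟ b
        ... | yes e | _     = inj₁ e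
        ... | no _  | yes e = inj₂ e
        ... | no w≢a | no w≢b =
          contradiction (Any.map (λ { refl → Box↗⇒Box box , w≢a , w≢b }) w∈P) ¬sat
      ... | yes sat with w , w∈P , box , w≢a , w≢b ← List.find sat
                    with (l , r) , (t , d) ← Box⇒Box↗ {a} {b} {w} (ℚ.<⇒≤ (separated La ¬Lb)) b≤a box
                    with Left? w
      ...   | yes Lw =
        let u , v , c = go (rec (length-filter-< (Box↗? w b) (Box↗? a b) widen a∈P excluded
                                  ((ℚ.≤-refl , ℚ.≤-trans l r) , (b≤a , ℚ.≤-refl))))
                           w∈P b∈P Lw ¬Lb t
            open Crossing c
        in u , v , record { Crossing c ; box-u = widen box-u ; box-v = widen box-v }
        where
        widen : ∀ {c} → Box↗ w b c → Box↗ a b c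
        widen ((l′ , r′) , (t′ , d′)) = (ℚ.≤-trans l l′ , r′) , (t′ , ℚ.≤-trans d′ d)

        excluded : ¬ Box↗ w b a
        excluded ((l′ , _) , (_ , d′)) =
          w≢a (cong₂ point (injective (ℚ.≤-antisym l′ l)) (ℚ.≤-antisym d d′))
      ...   | no ¬Lw =
        let u , v , c = go (rec (length-filter-< (Box↗? a w) (Box↗? a b) widen b∈P excluded
                                  ((ℚ.≤-trans l r , ℚ.≤-refl) , (ℚ.≤-refl , b≤a))))
                           a∈P w∈P La ¬Lw d
            open Crossing c
        in u , v , record { Crossing c ; box-u = widen box-u ; box-v = widen box-v }
        where
        widen : ∀ {c} → Box↗ a w c → Box↗ a b c
        widen ((l′ , r′) , (t′ , d′)) = (l′ , ℚ.≤-trans r′ r) , (ℚ.≤-trans t t′ , d′)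

        excluded : ¬ Box↗ a w b
        excluded ((_ , r′) , (t′ , _)) =
          w≢b (cong₂ point (injective (ℚ.≤-antisym r r′)) (ℚ.≤-antisym t′ t))

    crossing : ∀ {a b} → a ∈ P → b ∈ P → Left a → ¬ Left b → y b ≤ y a →
               ∃ λ u → ∃ λ v → Crossing P Left a b u v
    crossing = go (<-wellFounded _)

  -- Leftmost points of rows

  record Leftmost (P : List Point) (a b : Point) : Set where
    field
      b∈P     : b ∈ P
      level   : y b ≡ y a
      minimal : ∀ {c} → c ∈ P → y c ≡ y b → ξ b ≤ ξ c

  leftmost : ∀ P {a} → a ∈ P → ∃ (Leftmost P a)
  leftmost P = go (<-wellFounded _)
    where
    count : Point → ℕ
    count a = length (filter (λ c → ξ c ℚ.<? ξ a) P)

    go : ∀ {a} → Acc ℕ._<_ (count a) → a ∈ P → ∃ (Leftmost P a)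
    go {a} (acc rec) a∈P with Any.any? (λ c → (y c ℚ.≟ y a) ×-dec (ξ c ℚ.<? ξ a)) P
    ... | no ∄c = a , record
      { b∈P = a∈P ; level = refl
      ; minimal = λ c∈P c-a → ℚ.≮⇒≥ (λ c<a → ∄c (Any.map (λ { refl → c-a , c<a }) c∈P)) }
    ... | yes ∃c =
      let c , c∈P , c-a , c<a = List.find ∃c
          b , l = go (rec (length-filter-< (λ d → ξ d ℚ.<? ξ c) (λ d → ξ d ℚ.<? ξ a)
                             (λ d<c → ℚ.<-trans d<c c<a) c∈P (ℚ.<-irrefl refl) c<a)) c∈P
      in b , record { Leftmost l ; level = trans (Leftmost.level l) c-a }

  -- Points of Greedy in a Zag rectangle

  module Rectangles {X G : List Point}
    (rows : ∀ {a b} → a ∈ X → b ∈ X → y a ≡ y b → a ≡ b)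
    (columns : ∀ {a b} → a ∈ X → b ∈ X → x a ≡ x b → a ≡ b)
    (marked : ∀ {r} → r ∈ G → Marked X (X ++ G) r) where

    W = X ++ G

    -- Measure for inductions on marks: the point `a` that causes a mark has a smaller value.
    earlier : Point → ℕ
    earlier r = length (filter (λ c → y c ℚ.<? y r) W)

    earlier-< : ∀ {a r} → a ∈ W → y a < y r → earlier a ℕ.< earlier r
    earlier-< {a} {r} a∈W a<r = length-filter-< (λ c → y c ℚ.<? y a) (λ c → y c ℚ.<? y r)
      (λ c<a → ℚ.<-trans c<a a<r) a∈W (ℚ.<-irrefl refl) a<r

    -- Passing from a mark to the `a` above it in the same column must end in `X`.
    born : ∀ {r} → r ∈ G → ∃ λ a → a ∈ X × Above a r
    born = go (<-wellFounded _)
      where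
      go : ∀ {r} → Acc ℕ._<_ (earlier r) → r ∈ G → ∃ λ a → a ∈ X × Above a r
      go {r} (acc rec) r∈G with record { a = a ; a∈W = a∈W ; a-above = (x≡ , y<) } ← marked r∈G
                       with ∈-++⁻ X a∈W
      ... | inj₁ a∈X = a , a∈X , x≡ , y<
      ... | inj₂ a∈G =
        let b , b∈X , x≡′ , y<′ = go (rec (earlier-< {r = r} a∈W y<)) a∈G
        in b , b∈X , trans x≡′ x≡ , ℚ.<-trans y<′ y<

    module Rectangle {o o′} (R : ZagRectangle X G o o′) where

      open ZagRectangle R public

      q-p : x q ≡ x p
      q-p = first .proj₁ .proj₁

      ξ-q : ξ q ≡ ξ p
      ξ-q = cong σ q-p

      p∈W : p ∈ W
      p∈W = ∈-++⁺ʳ X p∈G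

      o′∈W : o′ ∈ W
      o′∈W = ∈-++⁺ˡ o′∈X

      q<o : y q < y o
      q<o = subst (y q <_) (sym y-o) (first .proj₁ .proj₂)

      o′<o : y o′ < y o
      o′<o = subst (_< y o) (sym y-o′) q<o

      nearest : ∀ {r} → r ∈ W → Above r p → y r ≤ y q
      nearest = All.lookup (first .proj₂)

      -- Greedy marked `p` because of some `a` above it whose box with `o` was empty. As the first
      -- point above `p`, `q` lies in that box, hence is `a`, and the emptiness carries over.
      clear : ∀ {c} → c ∈ W → y c < y o → Box o q c → c ≡ q
      clear {c} c∈W c<o box
        with record { s∈X = s∈X ; y-s = y-s ; a∈W = a∈W ; a-above = a-above ; clear = clear-s } ← marked p∈G
        with refl ← rows s∈X o∈X (trans y-s (sym y-o))
        with refl ← clear-s q∈W (first .proj₁ .proj₂)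
                      (Box↗⇒Box {o} ((ℚ.≤-trans (ℚ.<⇒≤ o-p) (ℚ.≤-reflexive (sym ξ-q))
                                    , ℚ.≤-reflexive (cong σ (trans q-p (sym (a-above .proj₁)))))
                                    , (nearest a∈W a-above , ℚ.<⇒≤ q<o)))
        = clear-s c∈W (subst (y c <_) y-o c<o) box

      clear↗ : ∀ {c} → c ∈ W → ξ o ≤ ξ c → ξ c ≤ ξ p → y o′ ≤ y c → y c < y o → c ≡ q
      clear↗ {c} c∈W l r t d = clear c∈W d
        (Box↗⇒Box {o} ((l , subst (ξ c ≤_) (sym ξ-q) r) , (subst (_≤ y c) y-o′ t , ℚ.<⇒≤ d)))

      -- A first mark inside the rectangle would be forced by an access outside
      -- it and a point above it, but o′ (for accesses on the right), q (for
      -- accesses on the left of a mark beyond p) or the emptiness of the box of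
      -- o and q (for the other marks) prevents that.
      interior-empty : ∀ {w} → w ∈ W → ξ o < ξ w → y o′ < y w → y w < y o → ξ o′ ≤ ξ w
      interior-empty w∈W o<w o′<w w<o =
        ℚ.≮⇒≥ (λ w<o′ → go (<-wellFounded _) w∈W o<w w<o′ o′<w w<o)
        where
        X-empty : ∀ {w} → w ∈ X → ξ o < ξ w → ξ w < ξ o′ → y o′ < y w → y w < y o → ⊥
        X-empty {w} w∈X l r t d = All.lookup good w∈X (between-<⁺ l r , vertical)
          where
          vertical : y o ⊓ y o′ < y w × y w < y o ⊔ y o′
          vertical = ℚ.≤-<-trans (ℚ.p⊓q≤q (y o) (y o′)) t , ℚ.<-≤-trans d (ℚ.p≤p⊔q (y o) (y o′))

        go : ∀ {w} → Acc ℕ._<_ (earlier w) → w ∈ W →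
             ξ o < ξ w → ξ w < ξ o′ → y o′ < y w → y w < y o → ⊥
        go {w} (acc rec) w∈W l r t d with ∈-++⁻ X w∈W
        ... | inj₁ w∈X = X-empty w∈X l r t d
        ... | inj₂ w∈G
          with record { s = s ; a = a ; s∈X = s∈X ; y-s = y-s ; a∈W = a∈W ; a-above = (a-w , a<w) ; clear = clear-s }
                 ← marked w∈G
          with y o′ ℚ.<? y a
        ...   | yes o′<a =
          go (rec (earlier-< {r = w} a∈W a<w)) a∈W (subst (ξ o <_) w-a l) (subst (_< ξ o′) w-a r) o′<a (ℚ.<-trans a<w d)
          where w-a = cong σ (sym a-w)
        ...   | no o′≮a with ξ o ℚ.<? ξ s | ξ s ℚ.<? ξ o′ | ξ w ℚ.≤? ξ p
        -- `s` shares the row of `w`; strictly between the two columns it would be a point of `X`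
        -- inside a good rectangle.
        ...     | yes o<s | yes s<o′ | _ =
          X-empty s∈X o<s s<o′ (subst (y o′ <_) (sym y-s) t) (subst (_< y o) (sym y-s) d)
        ...     | _ | no s≮o′ | _ = ℚ.<-irrefl (cong σ (trans (sym a-w) (cong x (sym o′≡a)))) r
          where
          a-w′ = cong σ a-w
          o′≡a : o′ ≡ a
          o′≡a = clear-s o′∈W t
            (Box↗⇒Box-upwards {s} {a} {o′} (ℚ.≤-trans (ℚ.≤-reflexive a-w′) (ℚ.<⇒≤ r)) (ℚ.≮⇒≥ s≮o′)
              (ℚ.≮⇒≥ o′≮a) (subst (y o′ ≤_) (sym y-s) (ℚ.<⇒≤ t)))
        ...     | no o≮s | yes _ | yes w≤p =
          ℚ.<-irrefl (trans y-o′ (cong y (sym (clear↗ w∈W (ℚ.<⇒≤ l) w≤p (ℚ.<⇒≤ t) d)))) t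
        ...     | no o≮s | yes _ | no w≰p =
          w≰p (ℚ.≤-reflexive (cong σ (trans (sym a-w) (trans (cong x (sym q≡a)) q-p))))
          where
          q≤ : ∀ {b} → y o′ ≤ b → y q ≤ b
          q≤ {b} = subst (_≤ b) y-o′
          q≡a : q ≡ a
          q≡a = clear-s q∈W (subst (_< y w) y-o′ t)
            (Box↗⇒Box {s} {a} {q}
              ((ℚ.≤-trans (ℚ.≮⇒≥ o≮s) (ℚ.≤-trans (ℚ.<⇒≤ o-p) (ℚ.≤-reflexive (sym ξ-q)))
               , ℚ.≤-trans (ℚ.≤-reflexive ξ-q) (ℚ.≤-trans (ℚ.<⇒≤ (ℚ.≰⇒> w≰p)) (ℚ.≤-reflexive (cong σ (sym a-w)))))
              , (subst (y a ≤_) y-o′ (ℚ.≮⇒≥ o′≮a) , q≤ (subst (y o′ ≤_) (sym y-s) (ℚ.<⇒≤ t)))))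

      -- The cut just beyond p, or just before p if p lies below o′.
      Left : Point → Set
      Left c = ξ c ≤ ξ p × ξ c < ξ o′

      Left? : Decidable Left
      Left? c = (ξ c ℚ.≤? ξ p) ×-dec (ξ c ℚ.<? ξ o′)

      Left-downward : ∀ {a b} → Left b → ξ a ≤ ξ b → Left a
      Left-downward (b≤p , b<o′) a≤b = ℚ.≤-trans a≤b b≤p , ℚ.≤-<-trans a≤b b<o′

      Left-separates : ∀ {a b} → Left a → ¬ Left b → ξ a < ξ b
      Left-separates {a} {b} La ¬Lb = ℚ.≰⇒> (¬Lb ∘ Left-downward {b} {a} La)

      Left-o : Left o
      Left-o = ℚ.<⇒≤ o-p , ℚ.<-≤-trans o-p p-o′

      ¬Left-o′ : ¬ Left o′
      ¬Left-o′ (_ , o′<o′) = ℚ.<-irrefl refl o′<o′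

    -- Charging pairs to points

    record Charge (P : List Point) (o o′ v : Point) : Set where
      field
        rectangle : ZagRectangle X G o o′
        -- Only the right end `v` is an index of the charge; `charge-injective` recovers `u` from
        -- it.
        {u}       : Point
        crosses   : Crossing P (Rectangle.Left rectangle) o o′ u v

    charge : ∀ {P o o′} → (∀ {a} → a ∈ X → a ∈ P) → ArborallySatisfied P →
             ZagRectangle X G o o′ → ∃ λ v → v ∈ P × Charge P o o′ v
    charge X⊆P satisfied R =
      let u , v , c = crossing satisfied Left? (λ {a} {b} → Left-downward {a} {b}) (X⊆P o∈X) (X⊆P o′∈X) Left-o ¬Left-o′ (ℚ.<⇒≤ o′<o)
      in v , Crossing.v∈P c , record { rectangle = R ; crosses = c }
      where open Rectangle R

    module _ {P o₁ o₁′ o₂ o₂′ u v} (R₁ : ZagRectangle X G o₁ o₁′) (R₂ : ZagRectangle X G o₂ o₂′)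
             (c₁ : Crossing P (Rectangle.Left R₁) o₁ o₁′ u v)
             (c₂ : Crossing P (Rectangle.Left R₂) o₂ o₂′ u v) where

      private
        module R₁ = Rectangle R₁
        module R₂ = Rectangle R₂
        module c₁ = Crossing c₁
        module c₂ = Crossing c₂

        v≤o₁′ : ξ v ≤ ξ o₁′
        v≤o₁′ = c₁.box-v .proj₁ .proj₂

        u<v : ξ u < ξ v
        u<v = R₁.Left-separates {u} {v} c₁.left c₁.right

      -- If `o₁′` were higher, `q₂` would lie on a row strictly inside the first rectangle, so
      -- `interior-empty` pushes it to the column of `o₁′` or beyond. Then the whole first
      -- rectangle, and with it `v`, is left of the second cut.
      same-bottom : o₁ ≡ o₂ → ¬ y o₁′ < y o₂′
      same-bottom refl o₁′<o₂′ = c₂.right (ℚ.≤-trans v≤o₁′ o₁′≤p₂ , ℚ.≤-<-trans v≤o₁′ o₁′<o₂′-x)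
        where
        o₁′≤p₂ : ξ o₁′ ≤ ξ R₂.p
        o₁′≤p₂ = subst (ξ o₁′ ≤_) R₂.ξ-q
          (R₁.interior-empty R₂.q∈W (subst (ξ o₁ <_) (sym R₂.ξ-q) R₂.o-p)
            (subst (y o₁′ <_) R₂.y-o′ o₁′<o₂′) R₂.q<o)

        o₁′<o₂′-x : ξ o₁′ < ξ o₂′
        -- Otherwise `o₁′`, `p₂` and `o₂′` share a column, and the two points of `X` coincide
        -- despite their different rows.
        o₁′<o₂′-x = ℚ.≰⇒> λ o₂′≤o₁′ → ℚ.<-irrefl
          (cong y (columns R₁.o′∈X R₂.o′∈X
            (injective (ℚ.≤-antisym (ℚ.≤-trans o₁′≤p₂ R₂.p-o′) o₂′≤o₁′))))
          o₁′<o₂′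

      -- If `o₂` were higher, the emptiness of both rectangles would force `o₁′ ≡ o₂′` and
      -- `q₁ ≡ q₂`, and the mark `p₂` would come between `p₁` and its first point above.
      not-below : ¬ y o₂ < y o₁
      not-below o₂<o₁ with ξ o₁ ℚ.<? ξ R₂.p
      -- Since `o₁ ≤ u ≤ p₂` in key, `p₂` is in the column of `o₁`, and it is higher. But a mark has
      -- a point of `X` above it, and here that could only be `o₁`.
      ... | no o₁≮p₂ =
        let a , a∈X , a-p₂ , a<p₂ = born R₂.p∈G
            o₁≤p₂ = ℚ.≤-trans (c₁.box-u .proj₁ .proj₁) (c₂.left .proj₁)
            p₂-o₁ = injective (ℚ.≤-antisym (ℚ.≮⇒≥ o₁≮p₂) o₁≤p₂)
            a<o₂  = subst (y a <_) (sym R₂.y-o) a<p₂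
        in ℚ.<-irrefl (cong y (columns a∈X R₁.o∈X (trans a-p₂ p₂-o₁))) (ℚ.<-trans a<o₂ o₂<o₁)
      ... | yes o₁<p₂ = ℚ.<-irrefl refl
        (ℚ.<-≤-trans (subst₂ _<_ R₁.y-o′ R₂.y-o o₁′<o₂) (R₁.nearest R₂.p∈W p₂-above-p₁))
        where
        o₂<o₁′ : ξ o₂ < ξ o₁′
        o₂<o₁′ = ℚ.≤-<-trans (c₂.box-u .proj₁ .proj₁) (ℚ.<-≤-trans u<v v≤o₁′)

        -- `v` is in both rectangles, so the top row of the first is not below the bottom row of the
        -- second; on a common row `o₂` would be `o₁′`.
        o₁′<o₂ : y o₁′ < y o₂
        o₁′<o₂ = ℚ.≰⇒> λ o₂≤o₁′ → ℚ.<-irrefl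
          (cong ξ (rows R₂.o∈X R₁.o′∈X
            (ℚ.≤-antisym o₂≤o₁′ (ℚ.≤-trans (c₁.box-v .proj₂ .proj₁) (c₂.box-v .proj₂ .proj₂)))))
          o₂<o₁′

        -- Otherwise `o₂` itself is in the interior of the first rectangle.
        o₂≤o₁ : ξ o₂ ≤ ξ o₁
        o₂≤o₁ = ℚ.≮⇒≥ λ o₁<o₂ → ℚ.<-irrefl refl
          (ℚ.<-≤-trans o₂<o₁′ (R₁.interior-empty (∈-++⁺ˡ R₂.o∈X) o₁<o₂ o₁′<o₂ o₂<o₁))

        o₁′≤p₂ : ξ o₁′ ≤ ξ R₂.p
        o₁′≤p₂ = R₁.interior-empty R₂.p∈W o₁<p₂ (subst (y o₁′ <_) R₂.y-o o₁′<o₂) (subst (_< y o₁) R₂.y-o o₂<o₁)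

        -- `v` is not left of the second cut although its key is at most that of `p₂`, so the bound
        -- by `o₂′` must be the one that fails.
        o₂′≤v : ξ o₂′ ≤ ξ v
        o₂′≤v = ℚ.≮⇒≥ λ v<o₂′ → c₂.right (ℚ.≤-trans v≤o₁′ o₁′≤p₂ , v<o₂′)

        o₂′≤o₁′ : ξ o₂′ ≤ ξ o₁′
        o₂′≤o₁′ = ℚ.≤-trans o₂′≤v v≤o₁′

        o₁′≡o₂′ : o₁′ ≡ o₂′
        o₁′≡o₂′ = columns R₁.o′∈X R₂.o′∈X (injective (ℚ.≤-antisym (ℚ.≤-trans o₁′≤p₂ R₂.p-o′) o₂′≤o₁′))

        -- The common `o′` puts both on one row, so `q₁` is in the box of `o₂` and `q₂`.
        q₁≡q₂ : R₁.q ≡ R₂.q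
        q₁≡q₂ = R₂.clear↗ R₁.q∈W
          (ℚ.≤-trans o₂≤o₁ (subst (ξ o₁ ≤_) (sym R₁.ξ-q) (ℚ.<⇒≤ R₁.o-p)))
          (subst (_≤ ξ R₂.p) (sym R₁.ξ-q) (ℚ.≤-trans R₁.p-o′ o₁′≤p₂))
          (ℚ.≤-reflexive (trans (cong y (sym o₁′≡o₂′)) R₁.y-o′))
          (subst (_< y o₂) R₁.y-o′ o₁′<o₂)

        p₂-above-p₁ : Above R₂.p R₁.p
        p₂-above-p₁ = trans (sym R₂.q-p) (trans (cong x (sym q₁≡q₂)) R₁.q-p)
                    , subst₂ _<_ R₂.y-o R₁.y-o o₂<o₁

    -- Of two left neighbours of `v`, the nearer one would lie on the segment from the other to `v`,
    -- so they agree. Then `not-below`, used both ways, equates the bottom rows and `same-bottom`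
    -- the top rows; a row holds only one point of `X`.
    charge-injective : ∀ {P o₁ o₁′ o₂ o₂′ v} → Charge P o₁ o₁′ v → Charge P o₂ o₂′ v →
                       (o₁ , o₁′) ≡ (o₂ , o₂′)
    charge-injective {P} {o₁} {o₁′} {o₂} {o₂′} {v}
      record { rectangle = R₁ ; u = u₁ ; crosses = c₁ } record { rectangle = R₂ ; u = u₂ ; crosses = c₂ }
      with same-u
      where
      module c₁ = Crossing c₁
      module c₂ = Crossing c₂

      u₁<v : ξ u₁ < ξ v
      u₁<v = Rectangle.Left-separates R₁ {u₁} {v} c₁.left c₁.right

      u₂<v : ξ u₂ < ξ v
      u₂<v = Rectangle.Left-separates R₂ {u₂} {v} c₂.left c₂.right

      same-u : u₁ ≡ u₂
      same-u with ℚ.≤-total (ξ u₁) (ξ u₂)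
      ... | inj₁ u₁≤u₂ with c₁.empty c₂.u∈P
                          ((u₁≤u₂ , ℚ.<⇒≤ u₂<v)
                            , (ℚ.≤-reflexive (sym c₂.level) , ℚ.≤-reflexive (trans c₂.level (sym c₁.level))))
      ...   | inj₁ e = sym e
      ...   | inj₂ e = contradiction u₂<v (ℚ.<-irrefl (cong ξ e))
      same-u | inj₂ u₂≤u₁ with c₂.empty c₁.u∈P
                                 ((u₂≤u₁ , ℚ.<⇒≤ u₁<v)
                            , (ℚ.≤-reflexive (sym c₁.level) , ℚ.≤-reflexive (trans c₁.level (sym c₂.level))))
      ...   | inj₁ e = e
      ...   | inj₂ e = contradiction u₁<v (ℚ.<-irrefl (cong ξ e))
    ... | refl with ℚ.<-cmp (y o₁) (y o₂)
    ...   | tri< o₁<o₂ _ _ = contradiction o₁<o₂ (not-below R₂ R₁ c₂ c₁)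
    ...   | tri> _ _ o₂<o₁ = contradiction o₂<o₁ (not-below R₁ R₂ c₁ c₂)
    ...   | tri≈ _ eq _ with rows (ZagRectangle.o∈X R₁) (ZagRectangle.o∈X R₂) eq | ℚ.<-cmp (y o₁′) (y o₂′)
    ...     | e | tri< o₁′<o₂′ _ _ = contradiction o₁′<o₂′ (same-bottom R₁ R₂ c₁ c₂ e)
    ...     | e | tri> _ _ o₂′<o₁′ = contradiction o₂′<o₁′ (same-bottom R₂ R₁ c₂ c₁ (sym e))
    ...     | e | tri≈ _ eq′ _ = cong₂ _,_ e (rows (ZagRectangle.o′∈X R₁) (ZagRectangle.o′∈X R₂) eq′)

    -- The lower bound for one orientation

    card-≥ : ∀ {P D} → (∀ {a} → a ∈ X → a ∈ P) → ArborallySatisfied P → Unique D →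
             (∀ {o o′} → (o , o′) List.∈ D → ZagRectangle X G o o′) →
             length D ℕ.+ card X ℕ.≤ card P
    card-≥ {P} {D} X⊆P satisfied uniq rectangle =
      subst (ℕ._≤ card P)
        (trans (length-++ (map inj₁ D)) (cong₂ ℕ._+_ (length-map inj₁ D) (length-map inj₂ (deduplicate _≟_ X))))
        (pigeonhole Selects injective-R
          (Unique.++⁺ (Unique.map⁺ (λ { refl → refl }) uniq)
                      (Unique.map⁺ (λ { refl → refl }) (Unique.deduplicate-! _≟_ X))
                      disjoint)
          image)
      where
      -- Pairs select their charged point, points of `X` the leftmost point of their row; `u` shows
      -- that a charged point is never leftmost.
      Selects : (Point × Point) ⊎ Point → Point → Set
      Selects (inj₁ (o , o′)) v = Charge P o o′ v
      Selects (inj₂ a)        v = a ∈ X × Leftmost P a v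

      not-leftmost : ∀ {a o o′ v} → Charge P o o′ v → ¬ Leftmost P a v
      not-leftmost {v = v} record { rectangle = R ; u = u ; crosses = c } l =
        Crossing.right c (Rectangle.Left-downward R {v} {u} (Crossing.left c)
          (Leftmost.minimal l (Crossing.u∈P c) (Crossing.level c)))

      injective-R : ∀ {e e′ v} → Selects e v → Selects e′ v → e ≡ e′
      injective-R {inj₁ _} {inj₁ _} c c′ = cong inj₁ (charge-injective c c′)
      injective-R {inj₁ _} {inj₂ _} c (_ , l) = contradiction l (not-leftmost c)
      injective-R {inj₂ _} {inj₁ _} (_ , l) c = contradiction l (not-leftmost c)
      injective-R {inj₂ _} {inj₂ _} (a∈X , l) (b∈X , m) =
        cong inj₂ (rows a∈X b∈X (trans (sym (Leftmost.level l)) (Leftmost.level m)))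

      disjoint : ∀ {e} → ¬ (e List.∈ map inj₁ D × e List.∈ map inj₂ (deduplicate _≟_ X))
      disjoint (e∈ , e∈′) with _ , _ , refl ← ∈-map⁻ inj₁ e∈ | _ , _ , () ← ∈-map⁻ inj₂ e∈′

      image : ∀ {e} → e List.∈ map inj₁ D ++ map inj₂ (deduplicate _≟_ X) →
              ∃ λ v → v ∈ deduplicate _≟_ P × Selects e v
      image e∈ with ∈-++⁻ (map inj₁ D) e∈
      ... | inj₁ e∈₁ with (o , o′) , d∈ , refl ← ∈-map⁻ inj₁ e∈₁ =
        let v , v∈P , c = charge X⊆P satisfied (rectangle d∈)
        in v , ∈-deduplicate⁺ _≟_ v∈P , c
      ... | inj₂ e∈₂ with a , a∈ , refl ← ∈-map⁻ inj₂ e∈₂ =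
        let a∈X = ∈-deduplicate⁻ _≟_ X a∈
            v , l = leftmost P (X⊆P a∈X)
        in v , ∈-deduplicate⁺ _≟_ (Leftmost.b∈P l) , a∈X , l

-- Why Greedy makes each mark

greedyFrom-row : ∀ P X {r} → r ∈ greedyFrom P X → ∃ λ s → s ∈ X × y s ≡ y r
greedyFrom-row P (p ∷ X) r∈ with ∈-++⁻ (marks P p) r∈
... | inj₁ r∈marks with _ , _ , refl ← ∈-map⁻ (λ a → point (x a) (y p)) r∈marks = p , here refl , refl
... | inj₂ r∈rest =
  let s , s∈X , s-r = greedyFrom-row (marks P p ++ p ∷ P) X r∈rest in s , there s∈X , s-r

weaken-Marked : ∀ {X X′ W r} → (∀ {s} → s ∈ X → s ∈ X′) → Marked X W r → Marked X′ W r
weaken-Marked X⊆X′ m = record { Marked m ; s∈X = X⊆X′ (Marked.s∈X m) }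

-- `W` stays fixed while `P` grows: the two inclusions say that it consists of `P`, `X` and the
-- marks still to come. By the sorting, the points of `W` before time `y p` all belong to `P`, so
-- the test made by Greedy against `P` speaks about `W`.
greedyFrom-marked : ∀ P X {W} →
  AllPairs (λ a b → y a < y b) X →
  (∀ {a p} → a ∈ P → p ∈ X → y a < y p) →
  (∀ {c} → c ∈ W → c ∈ P ⊎ c ∈ X ⊎ c ∈ greedyFrom P X) →
  (∀ {c} → c ∈ P ⊎ c ∈ X ⊎ c ∈ greedyFrom P X → c ∈ W) →
  ∀ {r} → r ∈ greedyFrom P X → Marked X W r
greedyFrom-marked P (p ∷ X) {W} (p<X ∷ sorted) P<X W⊆ ⊆W r∈ with ∈-++⁻ (marks P p) r∈
... | inj₁ r∈marks
      with a , a∈ , refl ← ∈-map⁻ (λ a → point (x a) (y p)) r∈marks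
      with a∈P , _ , unsatisfied ← ∈-filter⁻ (λ a → ¬? (x a ℚ.≟ x p) ×-dec ¬? (Satisfied? (p ∷ P) p a)) {xs = P} a∈
      = record { s∈X = here refl ; y-s = refl ; a∈W = ⊆W (inj₁ a∈P)
               ; a-above = refl , P<X a∈P (here refl) ; clear = clear }
  where
  earlier⊆P : ∀ {c} → c ∈ W → y c < y p → c ∈ P
  earlier⊆P {c} c∈W c<p with W⊆ c∈W
  ... | inj₁ c∈P = c∈P
  ... | inj₂ (inj₁ (here refl)) = contradiction c<p (ℚ.<-irrefl refl)
  ... | inj₂ (inj₁ (there c∈X)) = contradiction (ℚ.<-trans c<p (All.lookup p<X c∈X)) (ℚ.<-irrefl refl)
  ... | inj₂ (inj₂ c∈G) with greedyFrom-row P (p ∷ X) c∈G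
  ...   | s , here refl , s-c = contradiction c<p (ℚ.<-irrefl (sym s-c))
  ...   | s , there s∈X , s-c =
    contradiction (ℚ.<-trans c<p (subst (y p <_) s-c (All.lookup p<X s∈X))) (ℚ.<-irrefl refl)

  clear : ∀ {c} → c ∈ W → y c < y p → Box p a c → c ≡ a
  clear {c} c∈W c<p box = decidable-stable (c ≟ a) λ c≢a → unsatisfied
    (there (Any.map (λ { refl → box , (λ e → ℚ.<-irrefl (cong y e) c<p) , c≢a }) (earlier⊆P c∈W c<p)))
... | inj₂ r∈rest = weaken-Marked there
  (greedyFrom-marked (marks P p ++ p ∷ P) X sorted P′<X W⊆′ ⊆W′ r∈rest)
  where
  P′<X : ∀ {a q} → a ∈ marks P p ++ p ∷ P → q ∈ X → y a < y q
  P′<X a∈ q∈X with ∈-++⁻ (marks P p) a∈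
  ... | inj₁ a∈marks with _ , _ , refl ← ∈-map⁻ (λ a → point (x a) (y p)) a∈marks = All.lookup p<X q∈X
  ... | inj₂ (here refl) = All.lookup p<X q∈X
  ... | inj₂ (there a∈P) = P<X a∈P (there q∈X)

  rest = greedyFrom (marks P p ++ p ∷ P) X

  W⊆′ : ∀ {c} → c ∈ W → c ∈ marks P p ++ p ∷ P ⊎ c ∈ X ⊎ c ∈ rest
  W⊆′ c∈W with W⊆ c∈W
  ... | inj₁ c∈P = inj₁ (∈-++⁺ʳ (marks P p) (there c∈P))
  ... | inj₂ (inj₁ (here refl)) = inj₁ (∈-++⁺ʳ (marks P p) (here refl))
  ... | inj₂ (inj₁ (there c∈X)) = inj₂ (inj₁ c∈X)
  ... | inj₂ (inj₂ c∈G) with ∈-++⁻ (marks P p) c∈G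
  ...   | inj₁ c∈marks = inj₁ (∈-++⁺ˡ c∈marks)
  ...   | inj₂ c∈rest = inj₂ (inj₂ c∈rest)

  ⊆W′ : ∀ {c} → c ∈ marks P p ++ p ∷ P ⊎ c ∈ X ⊎ c ∈ rest → c ∈ W
  ⊆W′ (inj₂ (inj₁ c∈X)) = ⊆W (inj₂ (inj₁ (there c∈X)))
  ⊆W′ (inj₂ (inj₂ c∈rest)) = ⊆W (inj₂ (inj₂ (∈-++⁺ʳ (marks P p) c∈rest)))
  ⊆W′ (inj₁ c∈) with ∈-++⁻ (marks P p) c∈
  ... | inj₁ c∈marks = ⊆W (inj₂ (inj₂ (∈-++⁺ˡ c∈marks)))
  ... | inj₂ (here refl) = ⊆W (inj₂ (inj₁ (here refl)))
  ... | inj₂ (there c∈P) = ⊆W (inj₁ c∈P)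

greedy-marked : ∀ {X} → AllPairs (λ a b → y a < y b) X →
                ∀ {r} → r ∈ greedy X → Marked X (X ++ greedy X) r
greedy-marked {X} sorted = greedyFrom-marked [] X sorted (λ ()) (inj₂ ∘ ∈-++⁻ X)
  λ { (inj₂ (inj₁ c∈X)) → ∈-++⁺ˡ c∈X ; (inj₂ (inj₂ c∈G)) → ∈-++⁺ʳ X c∈G }

-- From good Zag pairs to oriented rectangles

good-zag-rectangle : ∀ X {o o′} → (o , o′) List.∈ Good X (Zag X) →
  (x o < x o′ × Oriented.ZagRectangle increasing X (greedy X) o o′) ⊎
  (x o′ < x o × Oriented.ZagRectangle decreasing X (greedy X) o o′)
good-zag-rectangle X {o} {o′} e∈
  with e∈Zag , good ← ∈-filter⁻ (IsGood? X) {xs = Zag X} e∈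
  with _ , inZag ← ∈-filter⁻ (InZag? X) {xs = cartesianProduct X X} e∈Zag
  with p , p∈G , ∃q ← List.find inZag
  with q , q∈W , first , (o∈X , y-o) , (o′∈X , y-o′) , condition ← List.find ∃q
  with condition
-- `p` lies strictly beyond `o` and at most as far as `o′`, so the pair alone fixes the orientation;
-- the comparison is returned so that pairs can be split without knowing `p`.
... | inj₁ ((_ , o<p) , side) = inj₁ (ℚ.<-≤-trans o<p p≤o′ , record
  { p∈G = p∈G ; q∈W = q∈W ; first = first ; o∈X = o∈X ; o′∈X = o′∈X ; y-o = y-o ; y-o′ = y-o′
  ; o-p = o<p ; p-o′ = p≤o′ ; good = good })
  where
  p≤o′ : x p ≤ x o′
  p≤o′ = [ ℚ.≤-reflexive ∘ sym ∘ proj₁ , ℚ.<⇒≤ ∘ proj₁ ]′ side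
... | inj₂ ((_ , p<o) , side) = inj₂ (ℚ.≤-<-trans o′≤p p<o , record
  { p∈G = p∈G ; q∈W = q∈W ; first = first ; o∈X = o∈X ; o′∈X = o′∈X ; y-o = y-o ; y-o′ = y-o′
  ; o-p = ℚ.neg-antimono-< p<o ; p-o′ = ℚ.neg-antimono-≤ o′≤p ; good = good })
  where
  o′≤p : x o′ ≤ x p
  o′≤p = [ ℚ.≤-reflexive ∘ proj₁ , ℚ.<⇒≤ ∘ proj₁ ]′ side

-- Natural numbers as rationals

fromℕ-mono-< : ∀ {m n} → m ℕ.< n → fromℕ m < fromℕ n
fromℕ-mono-< {m} {n} m<n = ℚ.toℚᵘ-cancel-<
  (ℚᵘ.<-respˡ-≃ (ℚᵘ.≃-sym (ℚ.toℚᵘ-fromℚᵘ (ℚᵘ.mkℚᵘ (+ m) 0)))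
    (ℚᵘ.<-respʳ-≃ (ℚᵘ.≃-sym (ℚ.toℚᵘ-fromℚᵘ (ℚᵘ.mkℚᵘ (+ n) 0)))
      (ℚᵘ.*<* (ℤ.*-monoʳ-<-pos (+ 1) (ℤ.+<+ m<n)))))

fromℕ-injective : ∀ {m n} → fromℕ m ≡ fromℕ n → m ≡ n
fromℕ-injective {m} {n} eq with ℕ.<-cmp m n
... | tri< m<n _ _ = contradiction (fromℕ-mono-< m<n) (ℚ.<-irrefl eq)
... | tri≈ _ e _   = e
... | tri> _ _ n<m = contradiction (fromℕ-mono-< n<m) (ℚ.<-irrefl (sym eq))

half-+-≤ : ∀ {d m n} → d ℕ.+ m ℕ.* 2 ℕ.≤ n ℕ.* 2 → + d / 2 + fromℕ m ≤ fromℕ n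
half-+-≤ {d} {m} {n} le = ℚ.toℚᵘ-cancel-≤ (begin
  toℚᵘ (+ d / 2 + fromℕ m)              ≃⟨ ℚ.toℚᵘ-homo-+ (+ d / 2) (fromℕ m) ⟩
  -- `mkℚᵘ` takes the denominator minus one: the final 1 means halves, and 0 means integers.
  toℚᵘ (+ d / 2) ℚᵘ.+ toℚᵘ (fromℕ m)    ≃⟨ ℚᵘ.+-cong (ℚ.toℚᵘ-fromℚᵘ (ℚᵘ.mkℚᵘ (+ d) 1))
                                                    (ℚ.toℚᵘ-fromℚᵘ (ℚᵘ.mkℚᵘ (+ m) 0)) ⟩
  ℚᵘ.mkℚᵘ (+ d) 1 ℚᵘ.+ ℚᵘ.mkℚᵘ (+ m) 0  ≤⟨ ℚᵘ.*≤* (subst₂ ℤ._≤_ (sym lhs) (ℤ.pos-* n 2) (ℤ.+≤+ le)) ⟩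
  ℚᵘ.mkℚᵘ (+ n) 0                       ≃⟨ ℚ.toℚᵘ-fromℚᵘ (ℚᵘ.mkℚᵘ (+ n) 0) ⟨
  toℚᵘ (fromℕ n)                        ∎)
  where
  open ℚᵘ.≤-Reasoning
  lhs : (+ d ℤ.* + 1 ℤ.+ + m ℤ.* + 2) ℤ.* + 1 ≡ + (d ℕ.+ m ℕ.* 2)
  lhs = trans (ℤ.*-identityʳ _) (cong₂ ℤ._+_ (ℤ.*-identityʳ (+ d)) (sym (ℤ.pos-* m 2)))

-- The point set of a permutation

module _ {n} (π : Permutation′ n) where

  private
    at : Fin n → Point
    at i = point (fromℕ (ℕ.suc (Fin.toℕ (π ⟨$⟩ʳ i)))) (fromℕ (ℕ.suc (Fin.toℕ i)))

  points-rows : ∀ {a b} → a ∈ points π → b ∈ points π → y a ≡ y b → a ≡ b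
  points-rows a∈ b∈ eq with i , refl ← ∈-tabulate⁻ {f = at} a∈ | j , refl ← ∈-tabulate⁻ {f = at} b∈ =
    cong at (Fin.toℕ-injective (ℕ.suc-injective (fromℕ-injective eq)))

  points-columns : ∀ {a b} → a ∈ points π → b ∈ points π → x a ≡ x b → a ≡ b
  points-columns a∈ b∈ eq with i , refl ← ∈-tabulate⁻ {f = at} a∈ | j , refl ← ∈-tabulate⁻ {f = at} b∈ =
    cong at (Injection.injective (↔⇒↣ π) (Fin.toℕ-injective (ℕ.suc-injective (fromℕ-injective eq))))

  points-sorted : AllPairs (λ a b → y a < y b) (points π)
  points-sorted = AllPairs.tabulate⁺-< (fromℕ-mono-< ∘ ℕ.s<s)

-- Adding the two orientations

add-halves : ∀ a b c p → a ℕ.+ c ℕ.≤ p → b ℕ.+ c ℕ.≤ p → (a ℕ.+ b) ℕ.+ c ℕ.* 2 ℕ.≤ p ℕ.* 2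
add-halves a b c p a+c≤p b+c≤p = subst₂ ℕ._≤_
  (solve 3 (λ a b c → (a :+ c) :+ (b :+ c) := (a :+ b) :+ c :* con 2) refl a b c)
  (solve 1 (λ p → p :+ p := p :* con 2) refl p)
  (ℕ.+-mono-≤ a+c≤p b+c≤p)
  where open +-*-Solver

module _ {X P : List Point}
  (rows : ∀ {a b} → a ∈ X → b ∈ X → y a ≡ y b → a ≡ b)
  (columns : ∀ {a b} → a ∈ X → b ∈ X → x a ≡ x b → a ≡ b)
  (sorted : AllPairs (λ a b → y a < y b) X)
  (X⊆P : ∀ {a} → a ∈ X → a ∈ P) (satisfied : ArborallySatisfied P) where

  private
    D : List (Point × Point)
    D = deduplicate _≟²_ (Good X (Zag X))

    D-unique : Unique D
    D-unique = Unique.deduplicate-! _≟²_ (Good X (Zag X))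

    rightwards? : Decidable (λ (e : Point × Point) → x (proj₁ e) < x (proj₂ e))
    rightwards? (o , o′) = x o ℚ.<? x o′

    D₊ D₋ : List (Point × Point)
    D₊ = filter rightwards? D
    D₋ = filter (¬? ∘ rightwards?) D

    D₊-rectangle : ∀ {o o′} → (o , o′) List.∈ D₊ → Oriented.ZagRectangle increasing X (greedy X) o o′
    D₊-rectangle e∈ with e∈D , o<o′ ← ∈-filter⁻ rightwards? {xs = D} e∈
      with good-zag-rectangle X (∈-deduplicate⁻ _≟²_ (Good X (Zag X)) e∈D)
    ... | inj₁ (_ , R)    = R
    ... | inj₂ (o′<o , _) = contradiction (ℚ.<-trans o<o′ o′<o) (ℚ.<-irrefl refl)

    D₋-rectangle : ∀ {o o′} → (o , o′) List.∈ D₋ → Oriented.ZagRectangle decreasing X (greedy X) o o′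
    D₋-rectangle e∈ with e∈D , o≮o′ ← ∈-filter⁻ (¬? ∘ rightwards?) {xs = D} e∈
      with good-zag-rectangle X (∈-deduplicate⁻ _≟²_ (Good X (Zag X)) e∈D)
    ... | inj₁ (o<o′ , _) = contradiction o<o′ o≮o′
    ... | inj₂ (_ , R)    = R

    card-≥ : ∀ O {E} → Unique E →
             (∀ {o o′} → (o , o′) List.∈ E → Oriented.ZagRectangle O X (greedy X) o o′) →
             length E ℕ.+ card X ℕ.≤ card P
    card-≥ O = Oriented.Rectangles.card-≥ O rows columns (greedy-marked sorted) X⊆P satisfied

  -- `D₊` and `D₋` partition the distinct good pairs, and each obeys `card-≥` in its own
  -- orientation. The sum of the two bounds is kept doubled so that it stays in ℕ.
  card²-good-zag : card² (Good X (Zag X)) ℕ.+ card X ℕ.* 2 ℕ.≤ card P ℕ.* 2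
  card²-good-zag = subst (λ d → d ℕ.+ card X ℕ.* 2 ℕ.≤ card P ℕ.* 2) (length-filter-∁ rightwards? D)
    (add-halves (length D₊) (length D₋) (card X) (card P)
      (card-≥ increasing (Unique.filter⁺ rightwards? D-unique) D₊-rectangle)
      (card-≥ decreasing (Unique.filter⁺ (¬? ∘ rightwards?) D-unique) D₋-rectangle))

theorem9p2 : (n : ℕ) (π : Permutation′ n) (Opt : List Point) →
    IsOpt (points π) Opt →
    fromℕ (card (points π ++ Opt)) ≥ (+ card² (Good (points π) (Zag (points π)))) / 2 + fromℕ (card (points π))
theorem9p2 n π Opt opt =
  half-+-≤ {card² (Good X (Zag X))} {card X} {card (X ++ Opt)}
    (card²-good-zag {X} (points-rows π) (points-columns π) (points-sorted π) ∈-++⁺ˡ (IsOpt.satisfied opt))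
  where X = points π
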